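{- Let $p$ be a positive integer and let $m_0 = m_0(p)$ be the smallest positive integer for which $$\min_{m \geq p+2}\{\widetilde{F}_v(m|_p; m-1) - m\} = \widetilde{F}_v(m_0|_p; m_0-1) - m_0.$$ Then: (a) $\widetilde{F}_v(m|_p; m-1) = \widetilde{F}_v(m_0|_p; m_0-1) + m - m_0$ for all $m \geq m_0$; (b) if $m_0 > p+2$ and $G$ is an extremal graph in $\widetilde{\mathcal{H}}(m_0|_p; m_0-1)$ (i.e. $G \in \widetilde{\mathcal{H}}(m_0|_p; m_0-1)$ and $|V(G)| = \widetilde{F}_v(m_0|_p; m_0-1)$), then $G \overset{v}{\rightarrow} (2, m_0-2)$; (c) $m_0 < \widetilde{F}_v((p+2)|_p; p+1) - p$.
   Context: All graphs are finite, simple and undirected; $\omega(G)$ denotes the clique number of $G$. For positive integers $a_1,\dots,a_s$, write $G \overset{v}{\rightarrow} (a_1,\dots,a_s)$ if for every coloring of the vertices of $G$ in $s$ colors there is an $i\in\{1,\dots,s\}$ such that $G$ contains an $a_i$-clique all of whose vertices have color $i$. For positive integers $m,p$, write $G \overset{v}{\rightarrow} m|_p$ if $G \overset{v}{\rightarrow} (a_1,\dots,a_s)$ holds for every choice of positive integers $a_1,\dots,a_s$ ($s$ not fixed) with $\sum_{i=1}^s (a_i-1)+1 = m$ and $\max\{a_1,\dots,a_s\}\le p$. Let $\widetilde{\mathcal{H}}(m|_p; q) = \{G : G \overset{v}{\rightarrow} m|_p \text{ and } \omega(G) < q\}$ and $\widetilde{F}_v(m|_p; q) = \min\{|V(G)|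 : G \in \widetilde{\mathcal{H}}(m|_p; q)\}$. (The number $\widetilde{F}_v(m|_p; m-1)$ exists exactly when $m \ge p+2$.) -}

module Defs where

open import Data.Bool.Base using (Bool; true; false)
import Data.Bool.Properties as Bool
open import Data.Fin.Base using (Fin)
import Data.Fin.Properties as Fin
open import Data.Fin.Subset using (Subset; _∈_; ∣_∣)
open import Data.Fin.Subset.Properties using (_∈?_; anySubset?)
open import Data.Integer.Base using (ℤ; +_; _-_) renaming (_≤_ to _≤ℤ_)
open import Data.List.Base using (List; length; lookup; map; filter; upTo)
open import Data.List.Extrema.Nat using (max)
open import Data.List.Relation.Unary.All using (All)
open import Data.Nat.Base using (ℕ; suc; pred; _+_; _∸_; _≤_; _<_)
open import Data.Nat.ListAction using (sum)
import Data.Nat.Properties as ℕ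
open import Data.Product.Base using (_×_; ∃-syntax)
open import Relation.Binary.PropositionalEquality.Core using (_≡_; _≢_)
open import Relation.Nullary.Decidable using (Dec; ¬?; _→-dec_; _×-dec_)

record Graph : Set where
  field
    order      : ℕ
    adj        : Fin order → Fin order → Bool
    adj-sym    : ∀ x y → adj x y ≡ adj y x
    adj-irrefl : ∀ x → adj x x ≡ false

open Graph public

V : Graph → Set
V G = Fin (order G)

VertexSet : Graph → Set
VertexSet G = Subset (order G)

IsClique : (G : Graph) → VertexSet G → Set
IsClique G S = ∀ x y → x ∈ S → y ∈ S → x ≢ y → adj G x y ≡ true

isClique? : (G : Graph) (S : VertexSet G) → Dec (IsClique G S)
isClique? G S =
  Fin.all? λ x → Fin.all? λ y →
    (x ∈? S) →-dec ((y ∈? S) →-dec (¬? (x Fin.≟ y) →-dec (adj G x y Bool.≟ true)))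

HasClique : Graph → ℕ → Set
HasClique G k = ∃[ S ] IsClique G S × ∣ S ∣ ≡ k

hasClique? : (G : Graph) (k : ℕ) → Dec (HasClique G k)
hasClique? G k = anySubset? λ S → isClique? G S ×-dec (∣ S ∣ ℕ.≟ k)

ω : Graph → ℕ
ω G = max 0 (filter (hasClique? G) (upTo (suc (order G))))

-- G →ᵛ (a₁ , … , aₛ), with the colours indexed by the positions of the list.
infix 4 _→ᵛ_
_→ᵛ_ : Graph → List ℕ → Set
G →ᵛ as =
  (colour : V G → Fin (length as)) →
  ∃[ i ] ∃[ S ] IsClique G S × ∣ S ∣ ≡ lookup as i × (∀ x → x ∈ S → colour x ≡ i)

-- The relation G →ᵛ m|_p. The empty list (s = 0) is admitted only when m = 1.
infix 4 _→ᵛ_∣ₚ_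
_→ᵛ_∣ₚ_ : Graph → ℕ → ℕ → Set
G →ᵛ m ∣ₚ p =
  (as : List ℕ) → All (1 ≤_) as → sum (map pred as) + 1 ≡ m → max 0 as ≤ p → G →ᵛ as

H̃ : (m p q : ℕ) → Graph → Set
H̃ m p q G = (G →ᵛ m ∣ₚ p) × ω G < q

IsMinimum : {A : Set} → (A → A → Set) → (A → Set) → A → Set
IsMinimum _≼_ P x = P x × (∀ y → P y → x ≼ y)

-- IsF̃ᵥ m p q f says that the number F̃ᵥ(m|_p; q) exists and equals f.
IsF̃ᵥ : (m p q f : ℕ) → Set
IsF̃ᵥ m p q = IsMinimum _≤_ λ n → ∃[ G ] H̃ m p q G × order G ≡ n

-- d = F̃ᵥ(m|_p; m-1) - m
IsExcess : (p m : ℕ) → ℤ → Set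
IsExcess p m d = ∃[ f ] IsF̃ᵥ m p (m ∸ 1) f × d ≡ + f - + m

IsMinExcess : (p : ℕ) → ℤ → Set
IsMinExcess p = IsMinimum _≤ℤ_ λ d → ∃[ m ] p + 2 ≤ m × IsExcess p m d

IsM₀ : (p m₀ : ℕ) → Set
IsM₀ p = IsMinimum _≤_ λ m → 1 ≤ m × (∃[ d ] IsMinExcess p d × IsExcess p m d)

{-# OPTIONS --safe #-}

-- (a) and (b) compare consecutive values of m: joining a vertex to G takes G ∈ H̃(m|p; m-1) to
-- H̃((m+1)|p; m), so the excess F̃ᵥ - m never increases, and it is minimal from m₀ on.  Conversely, if an
-- independent set A of an extremal graph at m₀ met every (m₀-2)-clique, G - A would belong to
-- H̃((m₀-1)|p; m₀-2) and have fewer vertices, contradicting the choice of m₀.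
--
-- (c) rests on the bound n ≥ a + m for graphs with G →ᵛ m|p (p ≥ 2), G →ᵛ (2, a) and no (a+1)-clique.
-- Every vertex is missed by some a-clique, so Hajnal's exchange argument gives Hall's condition between a
-- maximum clique Q and V ∖ Q in the complement of G.  Matching Q into V ∖ Q colours G with n - a
-- colours, whereas G →ᵛ (2, …, 2) forces at least m.  For m₀ > p + 2 this is used with a = m₀ - 2; for
-- m₀ = p + 2 it is used with a = p after deleting two non-adjacent vertices.
module Submission where

open import Defs
open import Data.Bool.Base using (Bool; true; false)
import Data.Bool.Properties as Bool
open import Data.Empty using (⊥-elim)
open import Data.Fin.Base using (Fin; zero; suc; inject≤; fromℕ<)
import Data.Fin.Properties as Fin
open import Data.Fin.Subset
open import Data.Fin.Subset.Properties
import Data.Integer.Base as ℤ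
import Data.Integer.Properties as ℤ
open import Data.Integer.Tactic.RingSolver using () renaming (solve-∀ to ℤ-solve-∀)
open import Data.List.Base as List using (List; []; _∷_; filter; upTo)
open import Data.List.Extrema.Nat using (max; argmax-sel; v≤max⁺; max≤v⁺)
open import Data.List.Membership.Propositional using (lose)
open import Data.List.Membership.Propositional.Properties using (∈-filter⁺; ∈-filter⁻; ∈-upTo⁺)
open import Data.List.Relation.Unary.All as All using (All; []; _∷_)
open import Data.Nat.Base using (ℕ; zero; suc; pred; _+_; _∸_; _≤_; _<_; z≤n; s≤s; s≤s⁻¹)
open import Data.Nat.Induction using (<-rec)
open import Data.Nat.ListAction using () renaming (sum to sumᴸ)
import Data.Nat.Properties as ℕ
open import Data.Nat.Tactic.RingSolver using (solve-∀)
open import Data.Product.Base using (_×_; _,_; proj₁; proj₂; ∃-syntax; Σ-syntax)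
open import Data.Sum.Base using (_⊎_; inj₁; inj₂; [_,_]′)
open import Data.Vec.Base as Vec using (Vec; []; _∷_; here; there; tabulate)
import Data.Vec.Properties as Vec
open import Data.Vec.Relation.Unary.All using ([]; _∷_) renaming (All to Allᵛ)
import Data.Vec.Relation.Unary.All.Properties as Allᵛ
open import Function.Base using (_∘_; id)
open import Relation.Binary.PropositionalEquality
open import Relation.Nullary using (¬_; Dec; yes; no; does; contradiction)
open import Relation.Nullary.Decidable using (¬?; _×-dec_; _⊎-dec_; dec-true; decidable-stable)
open import Relation.Unary using (Decidable)

-- Finite subsets: comprehension, cardinality, images and enumeration.

module _ {n : ℕ} {P : Fin n → Set} (P? : Decidable P) where

  comprehension : Subset n
  comprehension = tabulate (λ x → does (P? x))

  ∈-comprehension⁺ : ∀ {x} → P x → x ∈ comprehension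
  ∈-comprehension⁺ {x} px = Vec.lookup⇒[]= x comprehension
    (trans (Vec.lookup∘tabulate _ x) (dec-true (P? x) px))

  ∈-comprehension⁻ : ∀ {x} → x ∈ comprehension → P x
  ∈-comprehension⁻ {x} x∈ with P? x | trans (sym (Vec.lookup∘tabulate (λ y → does (P? y)) x)) (Vec.[]=⇒lookup x∈)
  ... | yes px | _ = px
  ... | no  _  | ()

∣p∪q∣+∣p∩q∣≡∣p∣+∣q∣ : ∀ {n} (p q : Subset n) → ∣ p ∪ q ∣ + ∣ p ∩ q ∣ ≡ ∣ p ∣ + ∣ q ∣
∣p∪q∣+∣p∩q∣≡∣p∣+∣q∣ [] [] = refl
∣p∪q∣+∣p∩q∣≡∣p∣+∣q∣ (inside ∷ p) (inside ∷ q) = cong suc (trans (ℕ.+-suc _ _)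
  (trans (cong suc (∣p∪q∣+∣p∩q∣≡∣p∣+∣q∣ p q)) (sym (ℕ.+-suc _ _))))
∣p∪q∣+∣p∩q∣≡∣p∣+∣q∣ (inside ∷ p) (outside ∷ q) = cong suc (∣p∪q∣+∣p∩q∣≡∣p∣+∣q∣ p q)
∣p∪q∣+∣p∩q∣≡∣p∣+∣q∣ (outside ∷ p) (inside ∷ q) =
  trans (cong suc (∣p∪q∣+∣p∩q∣≡∣p∣+∣q∣ p q)) (sym (ℕ.+-suc _ _))
∣p∪q∣+∣p∩q∣≡∣p∣+∣q∣ (outside ∷ p) (outside ∷ q) = ∣p∪q∣+∣p∩q∣≡∣p∣+∣q∣ p q

∣p∪q∣≤∣p∣+∣q∣ : ∀ {n} (p q : Subset n) → ∣ p ∪ q ∣ ≤ ∣ p ∣ + ∣ q ∣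
∣p∪q∣≤∣p∣+∣q∣ p q = ℕ.≤-trans (ℕ.m≤m+n _ _) (ℕ.≤-reflexive (∣p∪q∣+∣p∩q∣≡∣p∣+∣q∣ p q))

∣p∪⁅x⁆∣≤1+∣p∣ : ∀ {n} (p : Subset n) x → ∣ p ∪ ⁅ x ⁆ ∣ ≤ suc ∣ p ∣
∣p∪⁅x⁆∣≤1+∣p∣ p x = ℕ.≤-trans (∣p∪q∣≤∣p∣+∣q∣ p ⁅ x ⁆)
  (ℕ.≤-reflexive (trans (cong (∣ p ∣ +_) (∣⁅x⁆∣≡1 x)) (ℕ.+-comm ∣ p ∣ 1)))

x∉p⇒∣p∪⁅x⁆∣≡1+∣p∣ : ∀ {n} {p : Subset n} {x} → x ∉ p → ∣ p ∪ ⁅ x ⁆ ∣ ≡ suc ∣ p ∣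
x∉p⇒∣p∪⁅x⁆∣≡1+∣p∣ {p = p} {x} x∉p = ℕ.≤-antisym (∣p∪⁅x⁆∣≤1+∣p∣ p x)
  (p⊂q⇒∣p∣<∣q∣ (p⊆p∪q ⁅ x ⁆ , x , q⊆p∪q p ⁅ x ⁆ (x∈⁅x⁆ x) , x∉p))

x∉p-x : ∀ {n} (p : Subset n) x → x ∉ p - x
x∉p-x (_ ∷ p) zero    ()
x∉p-x (_ ∷ p) (suc x) (there x∈) = x∉p-x p x x∈

∣p∣≡0⊎nonempty : ∀ {n} (p : Subset n) → ∣ p ∣ ≡ 0 ⊎ Nonempty p
∣p∣≡0⊎nonempty {n} p with nonempty? p
... | yes ne = inj₂ ne
... | no  ¬ne = inj₁ (trans (cong ∣_∣ (Empty-unique ¬ne)) (∣⊥∣≡0 n))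

image : ∀ {k n} → (Fin k → Fin n) → Subset n
image {zero}  f = ⊥
image {suc k} f = image (f ∘ suc) ∪ ⁅ f zero ⁆

∈-image⁻ : ∀ {k n} (f : Fin k → Fin n) {x} → x ∈ image f → ∃[ i ] f i ≡ x
∈-image⁻ {zero}  f x∈ = contradiction x∈ ∉⊥
∈-image⁻ {suc k} f x∈ with x∈p∪q⁻ (image (f ∘ suc)) ⁅ f zero ⁆ x∈
... | inj₁ x∈ₛ = let i , eq = ∈-image⁻ (f ∘ suc) x∈ₛ in suc i , eq
... | inj₂ x∈₀ = zero , sym (x∈⁅y⁆⇒x≡y _ x∈₀)

∣image∣ : ∀ {k n} (f : Fin k → Fin n) → (∀ {i j} → f i ≡ f j → i ≡ j) → ∣ image f ∣ ≡ k
∣image∣ {zero}  {n} f inj = ∣⊥∣≡0 n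
∣image∣ {suc k} f inj = trans (x∉p⇒∣p∪⁅x⁆∣≡1+∣p∣ f₀∉) (cong suc (∣image∣ (f ∘ suc) (Fin.suc-injective ∘ inj)))
  where
  f₀∉ : f zero ∉ image (f ∘ suc)
  f₀∉ f₀∈ with ∈-image⁻ (f ∘ suc) f₀∈
  ... | i , eq with inj eq
  ... | ()

enumerate : ∀ {n} (p : Subset n) → Fin ∣ p ∣ → Fin n
enumerate (inside  ∷ p) zero    = zero
enumerate (inside  ∷ p) (suc i) = suc (enumerate p i)
enumerate (outside ∷ p) i       = suc (enumerate p i)

enumerate-∈ : ∀ {n} (p : Subset n) i → enumerate p i ∈ p
enumerate-∈ (inside  ∷ p) zero    = here
enumerate-∈ (inside  ∷ p) (suc i) = there (enumerate-∈ p i)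
enumerate-∈ (outside ∷ p) i       = there (enumerate-∈ p i)

index : ∀ {n} {p : Subset n} {x} → x ∈ p → Fin ∣ p ∣
index {p = inside  ∷ p} here       = zero
index {p = inside  ∷ p} (there x∈) = suc (index x∈)
index {p = outside ∷ p} (there x∈) = index x∈

enumerate-index : ∀ {n} {p : Subset n} {x} (x∈p : x ∈ p) → enumerate p (index x∈p) ≡ x
enumerate-index {p = inside  ∷ p} here       = refl
enumerate-index {p = inside  ∷ p} (there x∈) = cong suc (enumerate-index x∈)
enumerate-index {p = outside ∷ p} (there x∈) = cong suc (enumerate-index x∈)

enumerate-injective : ∀ {n} (p : Subset n) {i j} → enumerate p i ≡ enumerate p j → i ≡ j
enumerate-injective (inside  ∷ p) {zero}  {zero}  eq = refl
enumerate-injective (inside  ∷ p) {suc i} {suc j} eq = cong suc (enumerate-injective p (Fin.suc-injective eq))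
enumerate-injective (outside ∷ p) eq = enumerate-injective p (Fin.suc-injective eq)

-- Cliques and the clique number.

-- Cliques as enumerations: distinctness of the vertices is forced by irreflexivity of adjacency.
IsCliqueMap : (G : Graph) {k : ℕ} → (Fin k → V G) → Set
IsCliqueMap G c = ∀ {i j} → i ≢ j → adj G (c i) (c j) ≡ true

Clique : Graph → ℕ → Set
Clique G k = Σ[ c ∈ (Fin k → V G) ] IsCliqueMap G c

Independent : (G : Graph) → (V G → Set) → Set
Independent G P = ∀ {x y} → P x → P y → adj G x y ≡ false

module _ (G : Graph) where

  true≢adj-irrefl : ∀ {x y} → x ≡ y → adj G x y ≢ true
  true≢adj-irrefl {x} refl eq with trans (sym eq) (adj-irrefl G x)
  ... | ()

  cliqueMap-injective : ∀ {k} {c : Fin k → V G} → IsCliqueMap G c → ∀ {i j} → c i ≡ c j → i ≡ j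
  cliqueMap-injective clq {i} {j} eq with i Fin.≟ j
  ... | yes i≡j = i≡j
  ... | no  i≢j = contradiction (clq i≢j) (true≢adj-irrefl eq)

  image-isClique : ∀ {k} {c : Fin k → V G} → IsCliqueMap G c → IsClique G (image c)
  image-isClique {c = c} clq x y x∈ y∈ x≢y with ∈-image⁻ c x∈ | ∈-image⁻ c y∈
  ... | i , refl | j , refl = clq (x≢y ∘ cong c)

  enumerate-isCliqueMap : ∀ {S} → IsClique G S → IsCliqueMap G (enumerate S)
  enumerate-isCliqueMap {S} clq i≢j =
    clq _ _ (enumerate-∈ S _) (enumerate-∈ S _) (i≢j ∘ enumerate-injective S)

  clique⇒hasClique : ∀ {k} → Clique G k → HasClique G k
  clique⇒hasClique (c , clq) = image c , image-isClique clq , ∣image∣ c (cliqueMap-injective clq)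

  hasClique⇒clique : ∀ {k} → HasClique G k → Clique G k
  hasClique⇒clique (S , clq , refl) = enumerate S , enumerate-isCliqueMap clq

  clique-≤ : ∀ {j k} → j ≤ k → Clique G k → Clique G j
  clique-≤ j≤k (c , clq) = c ∘ (λ i → inject≤ i j≤k) , λ i≢j → clq (i≢j ∘ Fin.inject≤-injective j≤k j≤k _ _)

  isClique-∣∣≤ : ∀ {a} → ¬ Clique G (suc a) → ∀ {S} → IsClique G S → ∣ S ∣ ≤ a
  isClique-∣∣≤ ¬K clq = ℕ.≮⇒≥ λ a<∣S∣ → ¬K (clique-≤ a<∣S∣ (hasClique⇒clique (_ , clq , refl)))

  clique⇒≤ω : ∀ {k} → Clique G k → k ≤ ω G
  clique⇒≤ω {k} K@(c , clq) = v≤max⁺ 0 _ (inj₂ (lose k∈ ℕ.≤-refl))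
    where k∈ = ∈-filter⁺ (hasClique? G) (∈-upTo⁺ (s≤s (Fin.injective⇒≤ (cliqueMap-injective clq)))) (clique⇒hasClique K)

  ω-clique : Clique G (ω G)
  ω-clique with argmax-sel id 0 (filter (hasClique? G) (upTo (suc (order G))))
  ... | inj₁ ω≡0 = subst (Clique G) (sym ω≡0) ((λ ()) , λ { {()} })
  ... | inj₂ ω∈  = hasClique⇒clique (proj₂ (∈-filter⁻ (hasClique? G) ω∈))

  ω<⇒¬clique : ∀ {q} → ω G < q → ¬ Clique G q
  ω<⇒¬clique ω<q K = ℕ.<⇒≱ ω<q (clique⇒≤ω K)

  ¬clique⇒ω< : ∀ {q} → ¬ Clique G q → ω G < q
  ¬clique⇒ω< ¬K = ℕ.≰⇒> λ q≤ω → ¬K (clique-≤ q≤ω ω-clique)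

-- Hajnal's exchange argument.

module _ (G : Graph) where

  -- The two sets may overlap; when `I ⊆ U`, the set `I` is itself a clique.
  Complete : VertexSet G → VertexSet G → Set
  Complete I U = ∀ x y → x ∈ I → y ∈ U → x ≢ y → adj G x y ≡ true

  -- Hajnal's exchange: I ∪ (R ∩ U) is a clique, so it has at most ∣R∣ vertices, whence
  -- ∣I∣ + ∣U∣ does not decrease when (I , U) is replaced by (I ∩ R , U ∪ R).
  ∣I∣+∣U∣≤n : ∀ {a} → (∀ {S} → IsClique G S → ∣ S ∣ ≤ a) →
    (∀ z → ∃[ R ] IsClique G R × ∣ R ∣ ≡ a × z ∉ R) →
    ∀ k I U → ∣ I ∣ ≤ k → I ⊆ U → Complete I U → ∣ I ∣ + ∣ U ∣ ≤ order G
  ∣I∣+∣U∣≤n {a} small missing k I U ∣I∣≤k I⊆U cmp with ∣p∣≡0⊎nonempty I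
  ... | inj₁ ∣I∣≡0 rewrite ∣I∣≡0 = ∣p∣≤n U
  ... | inj₂ (z , z∈I) with k | missing z
  ... | zero  | _ = contradiction (ℕ.<-≤-trans (ℕ.≤-<-trans z≤n (x∈p⇒∣p-x∣<∣p∣ z∈I)) ∣I∣≤k) λ ()
  -- `R` is chosen to miss some `z ∈ I`, so `I ∩ R` is strictly smaller than `I` and the recursion
  -- on `k` goes through.
  ... | suc k | R , clqR , ∣R∣≡a , z∉R = ℕ.≤-trans exchange
    (∣I∣+∣U∣≤n small missing k (I ∩ R) (U ∪ R) ∣I∩R∣≤k
      (λ x∈ → p⊆p∪q R (I⊆U (p∩q⊆p I R x∈))) cmp′)
    where
    ∣I∩R∣≤k : ∣ I ∩ R ∣ ≤ k
    ∣I∩R∣≤k = s≤s⁻¹ (ℕ.<-≤-trans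
      (p⊂q⇒∣p∣<∣q∣ (p∩q⊆p I R , z , z∈I , z∉R ∘ p∩q⊆q I R)) ∣I∣≤k)

    cmp′ : Complete (I ∩ R) (U ∪ R)
    cmp′ x y x∈ y∈ x≢y with x∈p∩q⁻ I R x∈ | x∈p∪q⁻ U R y∈
    ... | x∈I , _ | inj₁ y∈U = cmp x y x∈I y∈U x≢y
    ... | _ , x∈R | inj₂ y∈R = clqR x y x∈R y∈R x≢y

    K : VertexSet G
    K = I ∪ (R ∩ U)

    clqK : IsClique G K
    clqK x y x∈ y∈ x≢y with x∈p∪q⁻ I (R ∩ U) x∈ | x∈p∪q⁻ I (R ∩ U) y∈
    ... | inj₁ x∈I | inj₁ y∈I  = cmp x y x∈I (I⊆U y∈I) x≢y
    ... | inj₁ x∈I | inj₂ y∈RU = cmp x y x∈I (p∩q⊆q R U y∈RU) x≢y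
    ... | inj₂ x∈RU | inj₁ y∈I = trans (adj-sym G x y) (cmp y x y∈I (p∩q⊆q R U x∈RU) (x≢y ∘ sym))
    ... | inj₂ x∈RU | inj₂ y∈RU = clqR x y (p∩q⊆p R U x∈RU) (p∩q⊆p R U y∈RU) x≢y

    exchange : ∣ I ∣ + ∣ U ∣ ≤ ∣ I ∩ R ∣ + ∣ U ∪ R ∣
    -- Adding `∣ R ∩ U ∣ + ∣ R ∣` to both sides lets inclusion-exclusion be applied to `I` with
    -- `R ∩ U` and to `U` with `R`.
    exchange = ℕ.+-cancelʳ-≤ (∣ R ∩ U ∣ + ∣ R ∣) _ _ (begin
      ∣ I ∣ + ∣ U ∣ + (∣ R ∩ U ∣ + ∣ R ∣)
        ≡⟨ rearrange (∣ I ∣) (∣ U ∣) (∣ R ∩ U ∣) (∣ R ∣) ⟩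
      (∣ I ∣ + ∣ R ∩ U ∣) + (∣ U ∣ + ∣ R ∣)
        ≡⟨ cong₂ _+_ (∣p∪q∣+∣p∩q∣≡∣p∣+∣q∣ I (R ∩ U)) (∣p∪q∣+∣p∩q∣≡∣p∣+∣q∣ U R) ⟨
      (∣ K ∣ + ∣ I ∩ (R ∩ U) ∣) + (∣ U ∪ R ∣ + ∣ U ∩ R ∣)
        ≤⟨ ℕ.+-mono-≤
             (ℕ.+-mono-≤ (ℕ.≤-trans (small clqK) (ℕ.≤-reflexive (sym ∣R∣≡a)))
               (p⊆q⇒∣p∣≤∣q∣ λ x∈ → let x∈I , x∈RU = x∈p∩q⁻ I (R ∩ U) x∈ in
                 x∈p∩q⁺ (x∈I , p∩q⊆p R U x∈RU)))
             (ℕ.+-monoʳ-≤ ∣ U ∪ R ∣ (ℕ.≤-reflexive (cong ∣_∣ (∩-comm U R)))) ⟩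
      (∣ R ∣ + ∣ I ∩ R ∣) + (∣ U ∪ R ∣ + ∣ R ∩ U ∣)
        ≡⟨ rearrange′ (∣ R ∣) (∣ I ∩ R ∣) (∣ U ∪ R ∣) (∣ R ∩ U ∣) ⟩
      ∣ I ∩ R ∣ + ∣ U ∪ R ∣ + (∣ R ∩ U ∣ + ∣ R ∣) ∎)
      where
      open ℕ.≤-Reasoning
      rearrange : ∀ i u t r → i + u + (t + r) ≡ (i + t) + (u + r)
      rearrange = solve-∀
      rearrange′ : ∀ r i u t → (r + i) + (u + t) ≡ i + u + (t + r)
      rearrange′ = solve-∀

  -- Hall's condition in the complement graph and the colourings it yields.

  NonAdj : V G → V G → Set
  NonAdj x y = x ≢ y × adj G x y ≡ false

  nonAdj? : ∀ x y → Dec (NonAdj x y)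
  nonAdj? x y = ¬? (x Fin.≟ y) ×-dec (adj G x y Bool.≟ false)

  ¬nonAdj⇒adj : ∀ {x y} → x ≢ y → ¬ NonAdj x y → adj G x y ≡ true
  ¬nonAdj⇒adj x≢y ¬na = Bool.¬-not λ eq → ¬na (x≢y , eq)

  nonAdj⇒¬adj : ∀ {x y} → NonAdj x y → adj G x y ≢ true
  nonAdj⇒¬adj (_ , eq) eq′ with trans (sym eq) eq′
  ... | ()

  HasNonNeighbourIn : VertexSet G → V G → Set
  HasNonNeighbourIn T y = ∃[ x ] x ∈ T × NonAdj x y

  hasNonNeighbourIn? : ∀ T → Decidable (HasNonNeighbourIn T)
  hasNonNeighbourIn? T y = Fin.any? λ x → (x ∈? T) ×-dec nonAdj? x y

  -- The neighbourhood of `T` in the complement graph.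
  N̄ : VertexSet G → VertexSet G
  N̄ T = comprehension (hasNonNeighbourIn? T)

  ∈-N̄⁺ : ∀ {T x y} → x ∈ T → NonAdj x y → y ∈ N̄ T
  ∈-N̄⁺ {T} x∈T na = ∈-comprehension⁺ (hasNonNeighbourIn? T) (_ , x∈T , na)

  ∈-N̄⁻ : ∀ {T y} → y ∈ N̄ T → HasNonNeighbourIn T y
  ∈-N̄⁻ {T} = ∈-comprehension⁻ (hasNonNeighbourIn? T)

  N̄-mono : ∀ {T T′} → T ⊆ T′ → N̄ T ⊆ N̄ T′
  N̄-mono T⊆T′ y∈ with ∈-N̄⁻ y∈
  ... | x , x∈T , na = ∈-N̄⁺ (T⊆T′ x∈T) na

  -- A violation of Hall's condition for matching `X` into `S` in the complement. In use `X` is a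
  -- clique inside `S`, so `N̄ T` avoids `X` for `T ⊆ X` and partners come from outside `X`.
  Deficient : VertexSet G → VertexSet G → Set
  Deficient S X = ∃[ T ] T ⊆ X × ∣ N̄ T ∩ S ∣ < ∣ T ∣

  deficient? : ∀ S X → Dec (Deficient S X)
  deficient? S X = anySubset? λ T → (T ⊆? X) ×-dec (∣ N̄ T ∩ S ∣ ℕ.<? ∣ T ∣)

  -- Colours are natural numbers constrained on `S` only, so a colouring of a smaller set extends
  -- without any change of type.
  Colourable : VertexSet G → ℕ → Set
  Colourable S k = Σ[ f ∈ (V G → ℕ) ] (∀ {x} → x ∈ S → f x < k)
    × (∀ {x y} → x ∈ S → y ∈ S → f x ≡ f y → adj G x y ≡ false)

  pair-independent : ∀ {x y} → adj G x y ≡ false → Independent G (λ z → z ≡ x ⊎ z ≡ y)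
  pair-independent xy≡false (inj₁ refl) (inj₁ refl) = adj-irrefl G _
  pair-independent xy≡false (inj₁ refl) (inj₂ refl) = xy≡false
  pair-independent xy≡false (inj₂ refl) (inj₁ refl) = trans (adj-sym G _ _) xy≡false
  pair-independent xy≡false (inj₂ refl) (inj₂ refl) = adj-irrefl G _

  -- `A` receives the fresh colour `k`; vertices of `S` outside `A` keep their colours, all below
  -- `k`.
  colourable-extend : ∀ {S S′ k} (A : V G → Set) → Decidable A → Independent G A →
    (∀ {x} → x ∈ S → ¬ A x → x ∈ S′) → Colourable S′ k → Colourable S (suc k)
  colourable-extend {S} {S′} {k} A A? indep S⊆ (f , f< , proper) = g , g< , g-proper
    where
    g : V G → ℕ
    g x with A? x
    ... | yes _ = k
    ... | no  _ = f x
    g< : ∀ {x} → x ∈ S → g x < suc k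
    g< {x} x∈S with A? x
    ... | yes _ = ℕ.≤-refl
    ... | no ¬a = ℕ.m<n⇒m<1+n (f< (S⊆ x∈S ¬a))
    g-proper : ∀ {x y} → x ∈ S → y ∈ S → g x ≡ g y → adj G x y ≡ false
    g-proper {x} {y} x∈S y∈S eq with A? x | A? y
    ... | yes ax | yes ay = indep ax ay
    ... | yes _  | no ¬ay = contradiction (sym eq) (ℕ.<⇒≢ (f< (S⊆ y∈S ¬ay)))
    ... | no ¬ax | yes _  = contradiction eq (ℕ.<⇒≢ (f< (S⊆ x∈S ¬ax)))
    ... | no ¬ax | no ¬ay = proper (S⊆ x∈S ¬ax) (S⊆ y∈S ¬ay) eq

  colourable-size : ∀ k S → ∣ S ∣ ≤ k → Colourable S k
  colourable-size k S ∣S∣≤k with nonempty? S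
  ... | no ¬ne = (λ _ → 0) , (λ x∈ → contradiction (_ , x∈) ¬ne) , λ x∈ → contradiction (_ , x∈) ¬ne
  colourable-size zero S ∣S∣≤0 | yes (x , x∈S) =
    contradiction (ℕ.<-≤-trans (ℕ.≤-<-trans z≤n (x∈p⇒∣p-x∣<∣p∣ x∈S)) ∣S∣≤0) λ ()
  colourable-size (suc k) S ∣S∣≤k | yes (x , x∈S) =
    colourable-extend (_≡ x) (Fin._≟ x) (λ { refl refl → adj-irrefl G x })
      x∈p∧x≢y⇒x∈p-y
      (colourable-size k (S - x) (s≤s⁻¹ (ℕ.<-≤-trans (x∈p⇒∣p-x∣<∣p∣ x∈S) ∣S∣≤k)))

  module _ {S X : VertexSet G} (X⊆S : X ⊆ S) (clqX : IsClique G X) (hall : ¬ Deficient S X)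
           {x : V G} (x∈X : x ∈ X) where

    private
      ∣T∣≤∣N̄T∣ : ∀ T → T ⊆ X → ∣ T ∣ ≤ ∣ N̄ T ∩ S ∣
      ∣T∣≤∣N̄T∣ T T⊆X = ℕ.≮⇒≥ λ lt → hall (T , T⊆X , lt)

      Reducible : V G → Set
      Reducible y = y ∈ S × NonAdj x y × ¬ Deficient (S - x - y) (X - x)

    -- If no y works then every non-neighbour y of x lies in N̄ T for some tight T ⊆ X - x.
    -- Tight sets are closed under union, so one tight T has N̄ T ⊇ N̄ ⁅ x ⁆ ∩ S, and T ∪ ⁅ x ⁆ is deficient.
    hall-step : ∃[ y ] Reducible y
    hall-step with Fin.any? (λ y → (y ∈? S) ×-dec nonAdj? x y ×-dec ¬? (deficient? (S - x - y) (X - x)))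
    ... | yes found = found
    -- The search starts at the empty set, which is tight because its `N̄` is empty. Every round
    -- enlarges the set, so `order G` is enough fuel.
    ... | no ¬found = ⊥-elim (grow (order G) ⊥ ⊥⊆
            (p⊆q⇒∣p∣≤∣q∣ {p = N̄ ⊥ ∩ S} {q = ⊥} λ y∈ →
              contradiction (proj₁ (proj₂ (∈-N̄⁻ (p∩q⊆p (N̄ ⊥) S y∈)))) ∉⊥)
            (ℕ.m≤n+m (order G) _))
      where
      -- A set `T` deficient after deleting `x` and `y` was not deficient before. As `X` is a
      -- clique, `x ∉ N̄ T`, so the loss is due to `y` alone: `y ∈ N̄ T`, and only one vertex is
      -- lost, which makes `T` tight.
      tightAt : ∀ {y} → y ∈ S → NonAdj x y →
        ∃[ T ] T ⊆ X - x × ∣ N̄ T ∩ S ∣ ≤ ∣ T ∣ × y ∈ N̄ T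
      tightAt {y} y∈S na with deficient? (S - x - y) (X - x)
      ... | no ¬def = contradiction (y , y∈S , na , ¬def) ¬found
      ... | yes (T , T⊆ , lt) = T , T⊆ , tight , decidable-stable (y ∈? N̄ T) y∈N̄T
        where
        x∉N̄T : x ∉ N̄ T
        x∉N̄T x∈ with ∈-N̄⁻ x∈
        ... | t , t∈T , na′ = nonAdj⇒¬adj na′ (clqX t x (p─q⊆p X ⁅ x ⁆ (T⊆ t∈T)) x∈X (proj₁ na′))
        keep : ∀ {z} → z ∈ N̄ T ∩ S → z ≢ y → z ∈ N̄ T ∩ (S - x - y)
        keep {z} z∈ z≢y with x∈p∩q⁻ (N̄ T) S z∈
        ... | z∈N , z∈S = x∈p∩q⁺ (z∈N , x∈p∧x≢y⇒x∈p-y (x∈p∧x≢y⇒x∈p-y z∈S (λ { refl → x∉N̄T z∈N })) z≢y)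
        y∈N̄T : ¬ ¬ y ∈ N̄ T
        y∈N̄T y∉ = ℕ.<⇒≱ lt (ℕ.≤-trans (∣T∣≤∣N̄T∣ T (p─q⊆p X ⁅ x ⁆ ∘ T⊆))
          (p⊆q⇒∣p∣≤∣q∣ λ z∈ → keep z∈ λ { refl → y∉ (p∩q⊆p (N̄ T) S z∈) }))
        split : N̄ T ∩ S ⊆ (N̄ T ∩ (S - x - y)) ∪ ⁅ y ⁆
        split {z} z∈ with z Fin.≟ y
        ... | yes refl = q⊆p∪q _ ⁅ y ⁆ (x∈⁅x⁆ y)
        ... | no z≢y   = p⊆p∪q ⁅ y ⁆ (keep z∈ z≢y)
        tight : ∣ N̄ T ∩ S ∣ ≤ ∣ T ∣
        tight = ℕ.≤-trans (p⊆q⇒∣p∣≤∣q∣ split) (ℕ.≤-trans (∣p∪⁅x⁆∣≤1+∣p∣ (N̄ T ∩ (S - x - y)) y) lt)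

      grow : ∀ fuel T → T ⊆ X - x → ∣ N̄ T ∩ S ∣ ≤ ∣ T ∣ → ¬ (order G ≤ ∣ T ∣ + fuel)
      grow fuel T T⊆ tight bound
        with Fin.any? (λ y → (y ∈? S) ×-dec nonAdj? x y ×-dec ¬? (y ∈? N̄ T))
      ... | no ¬any = ℕ.<⇒≱ (s≤s tight) (begin
          suc ∣ T ∣                  ≡⟨ x∉p⇒∣p∪⁅x⁆∣≡1+∣p∣ (x∉p-x X x ∘ T⊆) ⟨
          ∣ T ∪ ⁅ x ⁆ ∣              ≤⟨ ∣T∣≤∣N̄T∣ (T ∪ ⁅ x ⁆) T∪x⊆X ⟩
          ∣ N̄ (T ∪ ⁅ x ⁆) ∩ S ∣     ≤⟨ p⊆q⇒∣p∣≤∣q∣ N̄⊆ ⟩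
          ∣ N̄ T ∩ S ∣               ∎)
        where
        open ℕ.≤-Reasoning
        T∪x⊆X : T ∪ ⁅ x ⁆ ⊆ X
        T∪x⊆X t∈ with x∈p∪q⁻ T ⁅ x ⁆ t∈
        ... | inj₁ t∈T = p─q⊆p X ⁅ x ⁆ (T⊆ t∈T)
        ... | inj₂ t∈x with x∈⁅y⁆⇒x≡y x t∈x
        ... | refl = x∈X
        N̄⊆ : N̄ (T ∪ ⁅ x ⁆) ∩ S ⊆ N̄ T ∩ S
        N̄⊆ {y} y∈ with x∈p∩q⁻ (N̄ (T ∪ ⁅ x ⁆)) S y∈
        ... | y∈N , y∈S with ∈-N̄⁻ y∈N
        ... | t , t∈ , na with x∈p∪q⁻ T ⁅ x ⁆ t∈
        ... | inj₁ t∈T = x∈p∩q⁺ (∈-N̄⁺ t∈T na , y∈S)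
        ... | inj₂ t∈x with x∈⁅y⁆⇒x≡y x t∈x
        ... | refl = x∈p∩q⁺ (decidable-stable (y ∈? N̄ T) (λ y∉ → ¬any (y , y∈S , na , y∉)) , y∈S)
      ... | yes (y , y∈S , na , y∉N̄T) with tightAt y∈S na
      ... | T′ , T′⊆ , tight′ , y∈N̄T′ = next fuel bound
        where
        -- Some `t ∈ T′` is a non-neighbour of `y`, and it cannot lie in `T` because `y ∉ N̄ T`.
        larger : ∣ T ∣ < ∣ T ∪ T′ ∣
        larger with ∈-N̄⁻ y∈N̄T′
        ... | t , t∈T′ , na′ = p⊂q⇒∣p∣<∣q∣
          (p⊆p∪q T′ , t , q⊆p∪q T T′ t∈T′ , λ t∈T → y∉N̄T (∈-N̄⁺ t∈T na′))

        T∪T′⊆ : T ∪ T′ ⊆ X - x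
        T∪T′⊆ t∈ = [ T⊆ , T′⊆ ]′ (x∈p∪q⁻ T T′ t∈)

        A B : VertexSet G
        A = N̄ T ∩ S
        B = N̄ T′ ∩ S

        N̄∪⊆ : N̄ (T ∪ T′) ∩ S ⊆ A ∪ B
        N̄∪⊆ z∈ with x∈p∩q⁻ (N̄ (T ∪ T′)) S z∈
        ... | z∈N , z∈S with ∈-N̄⁻ z∈N
        ... | t , t∈ , na′ with x∈p∪q⁻ T T′ t∈
        ... | inj₁ t∈T  = p⊆p∪q B (x∈p∩q⁺ (∈-N̄⁺ t∈T na′ , z∈S))
        ... | inj₂ t∈T′ = q⊆p∪q A B (x∈p∩q⁺ (∈-N̄⁺ t∈T′ na′ , z∈S))

        N̄∩⊆ : N̄ (T ∩ T′) ∩ S ⊆ A ∩ B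
        N̄∩⊆ z∈ with x∈p∩q⁻ (N̄ (T ∩ T′)) S z∈
        ... | z∈N , z∈S = x∈p∩q⁺
          ( x∈p∩q⁺ (N̄-mono (p∩q⊆p T T′) z∈N , z∈S)
          , x∈p∩q⁺ (N̄-mono (p∩q⊆q T T′) z∈N , z∈S))

        -- Submodularity of neighbourhood sizes; Hall's condition at `T ∩ T′` gives the lower bound
        -- on `A ∩ B`.
        tight∪ : ∣ N̄ (T ∪ T′) ∩ S ∣ ≤ ∣ T ∪ T′ ∣
        tight∪ = ℕ.+-cancelʳ-≤ ∣ T ∩ T′ ∣ _ _ (begin
          ∣ N̄ (T ∪ T′) ∩ S ∣ + ∣ T ∩ T′ ∣
            ≤⟨ ℕ.+-mono-≤ (p⊆q⇒∣p∣≤∣q∣ N̄∪⊆) (ℕ.≤-trans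
                 (∣T∣≤∣N̄T∣ (T ∩ T′) (p─q⊆p X ⁅ x ⁆ ∘ T⊆ ∘ p∩q⊆p T T′)) (p⊆q⇒∣p∣≤∣q∣ N̄∩⊆)) ⟩
          ∣ A ∪ B ∣ + ∣ A ∩ B ∣   ≡⟨ ∣p∪q∣+∣p∩q∣≡∣p∣+∣q∣ A B ⟩
          ∣ A ∣ + ∣ B ∣           ≤⟨ ℕ.+-mono-≤ tight tight′ ⟩
          ∣ T ∣ + ∣ T′ ∣          ≡⟨ ∣p∪q∣+∣p∩q∣≡∣p∣+∣q∣ T T′ ⟨
          ∣ T ∪ T′ ∣ + ∣ T ∩ T′ ∣ ∎)
          where open ℕ.≤-Reasoning

        next : ∀ fuel → ¬ (order G ≤ ∣ T ∣ + fuel)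
        next zero       bound = ℕ.<⇒≱ larger (ℕ.≤-trans (∣p∣≤n (T ∪ T′)) (subst (order G ≤_) (ℕ.+-identityʳ _) bound))
        next (suc fuel) bound = grow fuel (T ∪ T′) T∪T′⊆ tight∪
          (ℕ.≤-trans bound (ℕ.≤-trans (ℕ.≤-reflexive (ℕ.+-suc _ fuel)) (ℕ.+-monoˡ-≤ fuel larger)))

  -- Each vertex of `X` shares a colour with a matched non-neighbour outside `X`, and every other
  -- vertex has its own colour, so `∣ S ∣ - ∣ X ∣` colours suffice. The number `k` only bounds the
  -- recursion.
  hall-colourable : ∀ k S X c → ∣ X ∣ ≤ k → X ⊆ S → IsClique G X → ¬ Deficient S X →
    ∣ S ∣ ≤ c + ∣ X ∣ → Colourable S c
  hall-colourable k S X c ∣X∣≤k X⊆S clqX hall ∣S∣≤ with ∣p∣≡0⊎nonempty X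
  ... | inj₁ ∣X∣≡0 = colourable-size c S
    (ℕ.≤-trans ∣S∣≤ (ℕ.≤-reflexive (trans (cong (c +_) ∣X∣≡0) (ℕ.+-identityʳ c))))
  ... | inj₂ (x , x∈X) with hall-step X⊆S clqX hall x∈X
  ... | y , y∈S , (x≢y , xy≡false) , hall′ = next k c ∣X∣≤k ∣S∣≤
    where
    S′ X′ : VertexSet G
    S′ = S - x - y
    X′ = X - x
    y∉X : y ∉ X
    y∉X y∈X = nonAdj⇒¬adj (x≢y , xy≡false) (clqX x y x∈X y∈X x≢y)
    X′⊆X : X′ ⊆ X
    X′⊆X = p─q⊆p X ⁅ x ⁆
    X′⊆S′ : X′ ⊆ S′
    X′⊆S′ {z} z∈ = x∈p∧x≢y⇒x∈p-y (x∈p∧x≢y⇒x∈p-y (X⊆S (X′⊆X z∈)) (λ { refl → x∉p-x X x z∈ }))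
      λ { refl → y∉X (X′⊆X z∈) }
    ∣X∣≤1+∣X′∣ : ∣ X ∣ ≤ suc ∣ X′ ∣
    ∣X∣≤1+∣X′∣ = ℕ.≤-trans (p⊆q⇒∣p∣≤∣q∣ X⊆) (∣p∪⁅x⁆∣≤1+∣p∣ X′ x)
      where
      X⊆ : X ⊆ X′ ∪ ⁅ x ⁆
      X⊆ {z} z∈X with z Fin.≟ x
      ... | yes refl = q⊆p∪q X′ ⁅ x ⁆ (x∈⁅x⁆ x)
      ... | no z≢x   = p⊆p∪q ⁅ x ⁆ (x∈p∧x≢y⇒x∈p-y z∈X z≢x)
    2+∣S′∣≤∣S∣ : 2 + ∣ S′ ∣ ≤ ∣ S ∣
    2+∣S′∣≤∣S∣ = ℕ.≤-<-trans
      (x∈p⇒∣p-x∣<∣p∣ (x∈p∧x≢y⇒x∈p-y y∈S (x≢y ∘ sym))) (x∈p⇒∣p-x∣<∣p∣ (X⊆S x∈X))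
    next : ∀ k c → ∣ X ∣ ≤ k → ∣ S ∣ ≤ c + ∣ X ∣ → Colourable S c
    next zero _ ∣X∣≤0 _ =
      contradiction (ℕ.<-≤-trans (ℕ.≤-<-trans z≤n (x∈p⇒∣p-x∣<∣p∣ x∈X)) ∣X∣≤0) λ ()
    -- Without colours `S` is no larger than `X`, yet deleting `x` and `y` removes two vertices of
    -- `S` and only one of `X`, contradicting `X′ ⊆ S′`.
    next (suc k) zero _ ∣S∣≤∣X∣ = contradiction (begin-strict
      ∣ X′ ∣         ≤⟨ p⊆q⇒∣p∣≤∣q∣ X′⊆S′ ⟩
      ∣ S′ ∣         <⟨ s≤s⁻¹ (ℕ.≤-trans 2+∣S′∣≤∣S∣ (ℕ.≤-trans ∣S∣≤∣X∣ ∣X∣≤1+∣X′∣)) ⟩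
      ∣ X′ ∣         ∎) (ℕ.<-irrefl refl)
      where open ℕ.≤-Reasoning
    next (suc k) (suc c) ∣X∣≤ ∣S∣≤ = colourable-extend (λ z → z ≡ x ⊎ z ≡ y)
      (λ z → (z Fin.≟ x) ⊎-dec (z Fin.≟ y)) (pair-independent xy≡false)
      (λ z∈S ¬pair → x∈p∧x≢y⇒x∈p-y (x∈p∧x≢y⇒x∈p-y z∈S (¬pair ∘ inj₁)) (¬pair ∘ inj₂))
      (hall-colourable k S′ X′ c (s≤s⁻¹ (ℕ.<-≤-trans (x∈p⇒∣p-x∣<∣p∣ x∈X) ∣X∣≤))
        X′⊆S′ (λ u v u∈ v∈ → clqX u v (X′⊆X u∈) (X′⊆X v∈)) hall′
        (s≤s⁻¹ (s≤s⁻¹ (ℕ.≤-trans 2+∣S′∣≤∣S∣ (ℕ.≤-trans ∣S∣≤ (s≤s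
          (ℕ.≤-trans (ℕ.+-monoʳ-≤ c ∣X∣≤1+∣X′∣) (ℕ.≤-reflexive (ℕ.+-suc c _)))))))))

  -- For `T ⊆ Q` the exchange inequality applied to `T` and the complement of `N̄ T` reads
  -- `∣ T ∣ ≤ ∣ N̄ T ∣`, which is Hall's condition for `Q`.
  ⊤-colourable : ∀ {a} → ¬ Clique G (suc a) → HasClique G a →
    (∀ z → ∃[ R ] IsClique G R × ∣ R ∣ ≡ a × z ∉ R) →
    ∀ c → order G ≤ c + a → Colourable ⊤ c
  ⊤-colourable ¬K (Q , clqQ , refl) missing c n≤ =
    hall-colourable ∣ Q ∣ ⊤ Q c ℕ.≤-refl ⊆⊤ clqQ hall
      (ℕ.≤-trans (ℕ.≤-reflexive (∣⊤∣≡n (order G))) n≤)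
    where
    hall : ¬ Deficient ⊤ Q
    hall (T , T⊆Q , lt) = ℕ.<⇒≱ lt (ℕ.≤-trans ∣T∣≤∣N̄T∣ (ℕ.≤-reflexive (cong ∣_∣ (sym (∩-identityʳ (N̄ T))))))
      where
      T⊆∁N̄T : T ⊆ ∁ (N̄ T)
      T⊆∁N̄T {x} x∈T = x∉p⇒x∈∁p λ x∈N → let t , t∈T , na = ∈-N̄⁻ x∈N in
        nonAdj⇒¬adj na (clqQ t x (T⊆Q t∈T) (T⊆Q x∈T) (proj₁ na))
      complete : Complete T (∁ (N̄ T))
      complete x y x∈ y∈ x≢y = ¬nonAdj⇒adj x≢y λ na → x∈∁p⇒x∉p y∈ (∈-N̄⁺ x∈ na)
      ∣T∣≤∣N̄T∣ : ∣ T ∣ ≤ ∣ N̄ T ∣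
      ∣T∣≤∣N̄T∣ = ℕ.+-cancelʳ-≤ ∣ ∁ (N̄ T) ∣ _ _ (begin
        ∣ T ∣ + ∣ ∁ (N̄ T) ∣
          ≤⟨ ∣I∣+∣U∣≤n (isClique-∣∣≤ G ¬K) missing ∣ T ∣ T (∁ (N̄ T)) ℕ.≤-refl T⊆∁N̄T complete ⟩
        order G                           ≡⟨ ℕ.m+[n∸m]≡n (∣p∣≤n (N̄ T)) ⟨
        ∣ N̄ T ∣ + (order G ∸ ∣ N̄ T ∣)   ≡⟨ cong (∣ N̄ T ∣ +_) (∣∁p∣≡n∸∣p∣ (N̄ T)) ⟨
        ∣ N̄ T ∣ + ∣ ∁ (N̄ T) ∣           ∎)
        where open ℕ.≤-Reasoning

-- Arrow relations over vectors of demands.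

Mono : (G : Graph) {s : ℕ} → (V G → Fin s) → Fin s → ℕ → Set
Mono G colour i k = Σ[ K ∈ Clique G k ] ∀ j → colour (proj₁ K j) ≡ i

-- With vectors the number of colours is an index, so lowering one demand keeps the type of
-- colourings unchanged.
Arrow : Graph → {s : ℕ} → Vec ℕ s → Set
Arrow G {s} v = (colour : V G → Fin s) → ∃[ i ] Mono G colour i (Vec.lookup v i)

Admissible : ℕ → {s : ℕ} → Vec ℕ s → Set
Admissible p = Allᵛ λ a → 1 ≤ a × a ≤ p

weight : {s : ℕ} → Vec ℕ s → ℕ
weight v = Vec.sum (Vec.map pred v)

ArrowBounded : Graph → ℕ → ℕ → Set
ArrowBounded G m p = ∀ {s} (v : Vec ℕ s) → Admissible p v → weight v + 1 ≡ m → Arrow G v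

lookup-fromList : ∀ {A : Set} (xs : List A) i → Vec.lookup (Vec.fromList xs) i ≡ List.lookup xs i
lookup-fromList (x ∷ xs) zero    = refl
lookup-fromList (x ∷ xs) (suc i) = lookup-fromList xs i

-- Reduces a claim on vectors to those coming from lists without transport along an equation of
-- lengths.
fromList-elim : ∀ {A : Set} (P : ∀ {s} → Vec A s → Set) → (∀ xs → P (Vec.fromList xs)) → ∀ {s} (v : Vec A s) → P v
fromList-elim P h []      = h []
fromList-elim P h (x ∷ v) = fromList-elim (λ w → P (x ∷ w)) (λ xs → h (x ∷ xs)) v

weight-fromList : ∀ as → weight (Vec.fromList as) ≡ sumᴸ (List.map pred as)
weight-fromList []       = refl
weight-fromList (a ∷ as) = cong (pred a +_) (weight-fromList as)

max≤⇒All≤ : ∀ {p} as → max 0 as ≤ p → All (_≤ p) as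
max≤⇒All≤ as max≤p = All.tabulate λ a∈ →
  ℕ.≤-trans (v≤max⁺ 0 as (inj₂ (lose a∈ ℕ.≤-refl))) max≤p

module _ {G : Graph} where

  →ᵛ⇒Arrow : ∀ as → G →ᵛ as → Arrow G (Vec.fromList as)
  →ᵛ⇒Arrow as arr colour with arr colour
  ... | i , S , clq , ∣S∣≡ , mono = i ,
    subst (Mono G colour i) (trans ∣S∣≡ (sym (lookup-fromList as i)))
      ((enumerate S , enumerate-isCliqueMap G clq) , λ j → mono _ (enumerate-∈ S j))

  Arrow⇒→ᵛ : ∀ as → Arrow G (Vec.fromList as) → G →ᵛ as
  Arrow⇒→ᵛ as arr colour with arr colour
  ... | i , (c , clq) , mono = i , image c , image-isClique G clq ,
    trans (∣image∣ c (cliqueMap-injective G clq)) (lookup-fromList as i) ,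
    λ x x∈ → let j , eq = ∈-image⁻ c x∈ in trans (cong colour (sym eq)) (mono j)

  ∣ₚ⇒ArrowBounded : ∀ {m p} → G →ᵛ m ∣ₚ p → ArrowBounded G m p
  ∣ₚ⇒ArrowBounded {m} {p} arr = fromList-elim (λ v → Admissible p v → weight v + 1 ≡ m → Arrow G v)
    λ as adm wt → →ᵛ⇒Arrow as (arr as (All.map proj₁ (Allᵛ.fromList⁻ adm))
      (trans (cong (_+ 1) (sym (weight-fromList as))) wt)
      (max≤v⁺ z≤n (All.map proj₂ (Allᵛ.fromList⁻ adm))))

  ArrowBounded⇒∣ₚ : ∀ {m p} → ArrowBounded G m p → G →ᵛ m ∣ₚ p
  ArrowBounded⇒∣ₚ arr as 1≤ wt max≤p = Arrow⇒→ᵛ as (arr (Vec.fromList as)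
    (Allᵛ.fromList⁺ (All.zip (1≤ , max≤⇒All≤ as max≤p)))
    (trans (cong (_+ 1) (weight-fromList as)) wt))

-- Cones: the join of a graph with one new vertex.

cone : Graph → Graph
cone G = record
  { order      = suc (order G)
  ; adj        = adj′
  ; adj-sym    = λ { zero zero → refl ; zero (suc _) → refl ; (suc _) zero → refl ; (suc x) (suc y) → adj-sym G x y }
  ; adj-irrefl = λ { zero → refl ; (suc x) → adj-irrefl G x }
  }
  where
  adj′ : Fin (suc (order G)) → Fin (suc (order G)) → Bool
  adj′ zero    zero    = false
  adj′ zero    (suc _) = true
  adj′ (suc _) zero    = true
  adj′ (suc x) (suc y) = adj G x y

module _ (G : Graph) {s : ℕ} (colour : Fin (suc (order G)) → Fin s) {i : Fin s} where

  mono-base : ∀ {k} → Mono G (colour ∘ suc) i k → Mono (cone G) colour i k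
  mono-base ((c , clq) , mono) = (suc ∘ c , clq) , mono

  mono-apex : ∀ {k} → colour zero ≡ i → Mono G (colour ∘ suc) i k → Mono (cone G) colour i (suc k)
  mono-apex {k} c₀≡i ((c , clq) , mono) = (c′ , clq′) , mono′
    where
    c′ : Fin (suc k) → Fin (suc (order G))
    c′ zero    = zero
    c′ (suc j) = suc (c j)
    clq′ : IsCliqueMap (cone G) c′
    clq′ {zero}  {zero}  i≢j = contradiction refl i≢j
    clq′ {zero}  {suc _} _   = refl
    clq′ {suc _} {zero}  _   = refl
    clq′ {suc _} {suc _} i≢j = clq (i≢j ∘ cong suc)
    mono′ : ∀ j → colour (c′ j) ≡ i
    mono′ zero    = c₀≡i
    mono′ (suc j) = mono j

weight-pred : ∀ {s} (v : Vec ℕ s) i → 2 ≤ Vec.lookup v i → suc (weight (Vec.updateAt v i pred)) ≡ weight v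
weight-pred (suc (suc a) ∷ v) zero    _   = refl
weight-pred (suc zero ∷ v)    zero    (s≤s ())
weight-pred (a ∷ v)           (suc i) 2≤a = trans (sym (ℕ.+-suc (pred a) _)) (cong (pred a +_) (weight-pred v i 2≤a))

admissible-pred : ∀ {p s} {v : Vec ℕ s} i → 2 ≤ Vec.lookup v i → Admissible p v → Admissible p (Vec.updateAt v i pred)
admissible-pred zero    2≤a ((_ , a≤p) ∷ adm) = (ℕ.pred-mono-≤ 2≤a , ℕ.≤-trans ℕ.pred[n]≤n a≤p) ∷ adm
admissible-pred (suc i) 2≤a (a-adm ∷ adm)     = a-adm ∷ admissible-pred i 2≤a adm

Fin≤1-unique : ∀ {k} → k ≤ 1 → (i j : Fin k) → i ≡ j
Fin≤1-unique (s≤s z≤n) zero zero = refl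

-- The apex together with a clique one smaller than required in its own colour class has the required size.
cone-ArrowBounded : ∀ {G m p} → ArrowBounded G m p → ArrowBounded (cone G) (suc m) p
cone-ArrowBounded {G} arr v adm wt colour with Vec.lookup v (colour zero) ℕ.≤? 1
-- A demand of at most 1 in the colour of the apex is met by the apex alone.
... | yes a≤1 = colour zero , ((λ _ → zero) , λ i≢j → contradiction (Fin≤1-unique a≤1 _ _) i≢j) , λ _ → refl
-- Otherwise this demand can drop by one and remain positive, which lowers the weight to the value
-- that `G` handles.
... | no a≰1 with arr (Vec.updateAt v (colour zero) pred) (admissible-pred _ (ℕ.≰⇒> a≰1) adm)
                   (ℕ.suc-injective (trans (cong (_+ 1) (weight-pred v (colour zero) (ℕ.≰⇒> a≰1))) wt)) (colour ∘ suc)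
... | i , mono with i Fin.≟ colour zero
... | yes refl = i , subst (Mono (cone G) colour i)
        (trans (cong suc (Vec.lookup∘updateAt i v)) (suc-pred (ℕ.<⇒≤ (ℕ.≰⇒> a≰1))))
        (mono-apex G colour refl mono)
  where
  suc-pred : ∀ {a} → 1 ≤ a → suc (pred a) ≡ a
  suc-pred (s≤s _) = refl
... | no i≢c₀ = i , subst (Mono (cone G) colour i) (Vec.lookup∘updateAt′ i (colour zero) i≢c₀ v) (mono-base G colour mono)

-- A clique of the cone loses at most one vertex, the apex, when restricted to `G`.
cone-¬clique : ∀ {G q} → ¬ Clique G q → ¬ Clique (cone G) (suc q)
cone-¬clique {G} {q} ¬K K with clique⇒hasClique (cone G) K
... | b ∷ S , clq , eq = ¬K (clique-≤ G (q≤∣S∣ b eq) (enumerate S , enumerate-isCliqueMap G clqS))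
  where
  q≤∣S∣ : ∀ b → ∣ b ∷ S ∣ ≡ suc q → q ≤ ∣ S ∣
  q≤∣S∣ inside  eq = ℕ.≤-reflexive (sym (ℕ.suc-injective eq))
  q≤∣S∣ outside eq = ℕ.≤-trans (ℕ.n≤1+n q) (ℕ.≤-reflexive (sym eq))
  clqS : IsClique G S
  clqS x y x∈ y∈ x≢y = clq (suc x) (suc y) (there x∈) (there y∈) (x≢y ∘ Fin.suc-injective)

-- Induced subgraphs and the deletion of independent sets.

induced : (G : Graph) → VertexSet G → Graph
induced G S = record
  { order      = ∣ S ∣
  ; adj        = λ x y → adj G (enumerate S x) (enumerate S y)
  ; adj-sym    = λ x y → adj-sym G _ _
  ; adj-irrefl = λ x → adj-irrefl G _
  }

module _ (G : Graph) (S : VertexSet G) where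

  induced-clique⁻ : ∀ {k} → Clique (induced G S) k → Clique G k
  induced-clique⁻ (c , clq) = enumerate S ∘ c , clq

  induced-isCliqueMap⁺ : ∀ {k} {c : Fin k → V G} (c∈ : ∀ i → c i ∈ S) → IsCliqueMap G c →
    IsCliqueMap (induced G S) (λ i → index (c∈ i))
  induced-isCliqueMap⁺ c∈ clq {i} {j} i≢j =
    trans (cong₂ (adj G) (enumerate-index (c∈ i)) (enumerate-index (c∈ j))) (clq i≢j)

¬independent-2-clique : ∀ {G P} → Independent G P → ((c , _) : Clique G 2) → ¬ (∀ j → P (c j))
¬independent-2-clique indep (c , clq) mono with trans (sym (clq {zero} {suc zero} λ ())) (indep (mono zero) (mono (suc zero)))
... | ()

-- Colouring A with an additional colour of demand 2 cannot create a monochromatic 2-clique.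
remove-ArrowBounded : ∀ {G m p} {A : VertexSet G} → 2 ≤ p → Independent G (_∈ A) →
  ArrowBounded G (suc m) p → ArrowBounded (induced G (∁ A)) m p
remove-ArrowBounded {G} {A = A} 2≤p indep arr {s} v adm wt colour = result
  where
  colour′ : V G → Fin (suc s)
  colour′ x with x ∈? ∁ A
  ... | yes x∈ = suc (colour (index x∈))
  ... | no  _  = zero

  colour′≡zero : ∀ {x} → colour′ x ≡ zero → x ∈ A
  colour′≡zero {x} eq with x ∈? ∁ A
  colour′≡zero {x} () | yes _
  ... | no x∉ = x∉∁p⇒x∈p x∉

  colour′≡suc : ∀ {x i} → colour′ x ≡ suc i → Σ[ x∈ ∈ x ∈ ∁ A ] colour (index x∈) ≡ i
  colour′≡suc {x} eq with x ∈? ∁ A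
  ... | yes x∈ = x∈ , Fin.suc-injective eq
  colour′≡suc {x} () | no _

  result : ∃[ i ] Mono (induced G (∁ A)) colour i (Vec.lookup v i)
  result with arr (2 ∷ v) ((s≤s z≤n , 2≤p) ∷ adm) (cong suc wt) colour′
  ... | zero , K , mono = contradiction (colour′≡zero ∘ mono) (¬independent-2-clique {G} indep K)
  ... | suc i , (c , clq) , mono = i ,
    (_ , induced-isCliqueMap⁺ G (∁ A) (λ j → proj₁ (colour′≡suc (mono j))) clq) ,
    λ j → proj₂ (colour′≡suc (mono j))

-- Colour `P` with the colour of demand 2: independence rules that colour out, so the `a`-clique
-- lies in the other one.
arrow-2∷a-avoids : ∀ {G a} {P : V G → Set} → Arrow G (2 ∷ a ∷ []) → Decidable P → Independent G P →
  Σ[ K ∈ Clique G a ] (∀ j → ¬ P (proj₁ K j))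
arrow-2∷a-avoids {G} {a} {P} arr P? indep = result
  where
  colour : V G → Fin 2
  colour x with P? x
  ... | yes _ = zero
  ... | no  _ = suc zero

  colour≡zero : ∀ {x} → colour x ≡ zero → P x
  colour≡zero {x} eq with P? x
  ... | yes px = px
  colour≡zero {x} () | no _

  colour≡suc : ∀ {x i} → colour x ≡ suc i → ¬ P x
  colour≡suc {x} eq with P? x
  ... | no ¬px = ¬px
  colour≡suc {x} () | yes _

  result : Σ[ K ∈ Clique G a ] (∀ j → ¬ P (proj₁ K j))
  result with arr colour
  ... | zero     , K , mono = contradiction (colour≡zero ∘ mono) (¬independent-2-clique {G} indep K)
  ... | suc zero , K , mono = K , colour≡suc ∘ mono

arrow-2∷a⇒clique : ∀ {G a} → Arrow G (2 ∷ a ∷ []) → Clique G a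
arrow-2∷a⇒clique {G} arr = proj₁ (arrow-2∷a-avoids {G} {P = λ _ → Fin 0} arr (λ _ → no λ ()) λ ())

-- The lower bound `a + m` on the order.

weight-replicate-2 : ∀ k → weight (Vec.replicate k 2) ≡ k
weight-replicate-2 zero    = refl
weight-replicate-2 (suc k) = cong suc (weight-replicate-2 k)

admissible-replicate-2 : ∀ {p} k → 2 ≤ p → Admissible p (Vec.replicate k 2)
admissible-replicate-2 zero    2≤p = []
admissible-replicate-2 (suc k) 2≤p = (s≤s z≤n , 2≤p) ∷ admissible-replicate-2 k 2≤p

module _ {G : Graph} {m p : ℕ} (2≤p : 2 ≤ p) (arr : ArrowBounded G m p) where

  -- The demands `(2, …, 2)` with `m - 1` entries are admissible, and a proper colouring with at
  -- most `m - 1` colours has no monochromatic edge.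
  colourable⇒m≤ : ∀ {c} → Colourable G ⊤ c → m ≤ c
  colourable⇒m≤ {c} (f , f<c , proper) = ℕ.≮⇒≥ (λ c<m → impossible m c<m arr)
    where
    impossible : ∀ m → c < m → ¬ ArrowBounded G m p
    impossible (suc k) (s≤s c≤k) arr = contradiction
      (arr (Vec.replicate k 2) (admissible-replicate-2 k 2≤p)
        (trans (cong (_+ 1) (weight-replicate-2 k)) (ℕ.+-comm k 1)) colour) ¬mono
      where
      f<k : ∀ x → f x < k
      f<k x = ℕ.<-≤-trans (f<c ∈⊤) c≤k
      colour : V G → Fin k
      colour x = fromℕ< (f<k x)
      ¬mono : ¬ (∃[ i ] Mono G colour i (Vec.lookup (Vec.replicate k 2) i))
      ¬mono (i , mono) with subst (Mono G colour i) (Vec.lookup-replicate i 2) mono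
      ... | K , eq = ¬independent-2-clique {G} {λ x → colour x ≡ i}
        (λ {x} {y} ex ey → proper ∈⊤ ∈⊤ (Fin.fromℕ<-injective _ _ (f<k x) (f<k y) (trans ex (sym ey)))) K eq

  a+m≤order : ∀ {a} → ¬ Clique G (suc a) → Arrow G (2 ∷ a ∷ []) → a + m ≤ order G
  a+m≤order {a} ¬K arr₂ = begin
    a + m               ≤⟨ ℕ.+-monoʳ-≤ a (colourable⇒m≤ colouring) ⟩
    a + (order G ∸ a)   ≡⟨ ℕ.m+[n∸m]≡n a≤n ⟩
    order G             ∎
    where
    open ℕ.≤-Reasoning
    Q : Clique G a
    Q = arrow-2∷a⇒clique {G} arr₂
    a≤n : a ≤ order G
    a≤n = Fin.injective⇒≤ (cliqueMap-injective G (proj₂ Q))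
    -- A single vertex is independent, so some `a`-clique avoids it.
    missing : ∀ z → ∃[ R ] IsClique G R × ∣ R ∣ ≡ a × z ∉ R
    missing z with arrow-2∷a-avoids {G} {P = _≡ z} arr₂ (Fin._≟ z) (λ { refl refl → adj-irrefl G z })
    ... | (c , clq) , ¬≡z = image c , image-isClique G clq , ∣image∣ c (cliqueMap-injective G clq) , λ z∈ → let j , eq = ∈-image⁻ c z∈ in ¬≡z j eq
    colouring : Colourable G ⊤ (order G ∸ a)
    colouring = ⊤-colourable G ¬K (clique⇒hasClique G Q) missing (order G ∸ a)
      (ℕ.≤-reflexive (sym (ℕ.m∸n+n≡m a≤n)))

-- Minima and comparison of excesses.

-- `P` is not assumed decidable, so a least element is obtained only under double negation. That
-- suffices for deriving decidable inequalities.
minimum-¬¬ : ∀ {P : ℕ → Set} {n} → P n → ¬ ¬ (∃[ f ] IsMinimum _≤_ P f × f ≤ n)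
minimum-¬¬ {P} {n} pn ¬min = <-rec (λ k → k ≤ n → ¬ P k) step n ℕ.≤-refl pn
  where
  step : ∀ k → (∀ {j} → j < k → j ≤ n → ¬ P j) → k ≤ n → ¬ P k
  step k ih k≤n pk = ¬min (k , (pk , λ j pj → ℕ.≮⇒≥ λ j<k → ih j<k (ℕ.≤-trans (ℕ.<⇒≤ j<k) k≤n) pj) , k≤n)

minimum-unique : ∀ {P : ℕ → Set} {m n} → IsMinimum _≤_ P m → IsMinimum _≤_ P n → m ≡ n
minimum-unique (pm , m≤) (pn , n≤) = ℕ.≤-antisym (m≤ _ pn) (n≤ _ pm)

-‿≤⇒+-≤ : ∀ f m f′ m′ → ℤ.+ f ℤ.- ℤ.+ m ℤ.≤ ℤ.+ f′ ℤ.- ℤ.+ m′ → f + m′ ≤ f′ + m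
-‿≤⇒+-≤ f m f′ m′ le = ℤ.drop‿+≤+ (subst₂ ℤ._≤_
  (cancelˡ (ℤ.+ f) (ℤ.+ m) (ℤ.+ m′)) (cancelʳ (ℤ.+ f′) (ℤ.+ m) (ℤ.+ m′))
  (ℤ.+-monoˡ-≤ (ℤ.+ m ℤ.+ ℤ.+ m′) le))
  where
  cancelˡ : ∀ a b c → (a ℤ.- b) ℤ.+ (b ℤ.+ c) ≡ a ℤ.+ c
  cancelˡ = ℤ-solve-∀
  cancelʳ : ∀ a b c → (a ℤ.- c) ℤ.+ (b ℤ.+ c) ≡ a ℤ.+ b
  cancelʳ = ℤ-solve-∀

+-≡⇒-‿≡ : ∀ f m f′ m′ → f + m′ ≡ f′ + m → ℤ.+ f ℤ.- ℤ.+ m ≡ ℤ.+ f′ ℤ.- ℤ.+ m′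
+-≡⇒-‿≡ f m f′ m′ eq = trans (expand (ℤ.+ f) (ℤ.+ m) (ℤ.+ m′))
  (trans (cong (λ n → ℤ.+ n ℤ.- (ℤ.+ m ℤ.+ ℤ.+ m′)) eq) (collapse (ℤ.+ f′) (ℤ.+ m) (ℤ.+ m′)))
  where
  expand : ∀ a b c → a ℤ.- b ≡ (a ℤ.+ c) ℤ.- (b ℤ.+ c)
  expand = ℤ-solve-∀
  collapse : ∀ a b c → (a ℤ.+ b) ℤ.- (b ℤ.+ c) ≡ a ℤ.- c
  collapse = ℤ-solve-∀

-- Membership in `H̃` and the range of `m` in which it is possible.

module _ {m p q : ℕ} {G : Graph} where

  H̃⁺ : ArrowBounded G m p → ¬ Clique G q → H̃ m p q G
  H̃⁺ arr ¬K = ArrowBounded⇒∣ₚ {G} arr , ¬clique⇒ω< G ¬K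

  H̃⁻ : H̃ m p q G → ArrowBounded G m p × ¬ Clique G q
  H̃⁻ (arr , ω<q) = ∣ₚ⇒ArrowBounded {G} arr , ω<⇒¬clique G ω<q

-- The predicate whose least `n` is the number F̃ᵥ(m|p; m-1).
HasMember : (p m n : ℕ) → Set
HasMember p m n = ∃[ G ] H̃ m p (m ∸ 1) G × order G ≡ n

emptyGraph : Graph
emptyGraph = record { order = 0 ; adj = λ () ; adj-sym = λ () ; adj-irrefl = λ () }

weight-admissible-1 : ∀ {s} {v : Vec ℕ s} → Admissible 1 v → weight v ≡ 0
weight-admissible-1 []                          = refl
weight-admissible-1 ((s≤s z≤n , s≤s z≤n) ∷ adm) = weight-admissible-1 adm

-- For p = 1 the condition G →ᵛ m ∣ₚ 1 is vacuous for m ≥ 2, so the excess -m is unbounded below.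
¬isMinExcess-1 : ∀ {d} → ¬ IsMinExcess 1 d
¬isMinExcess-1 ((suc m , 3≤m , f , _ , refl) , least) =
  ℕ.<⇒≱ (ℕ.m≤n+m (2 + m) f) (-‿≤⇒+-≤ f (suc m) 0 (2 + m)
    (least _ (2 + m , ℕ.m≤n⇒m≤1+n 3≤m , 0 , ((emptyGraph , H̃⁺ {G = emptyGraph} vacuous noClique , refl) , λ _ _ → z≤n) , refl)))
  where
  vacuous : ArrowBounded emptyGraph (2 + m) 1
  vacuous v adm wt with trans (sym (cong (_+ 1) (weight-admissible-1 adm))) wt
  ... | ()
  noClique : ¬ Clique emptyGraph (suc m)
  noClique (c , _) with c zero
  ... | ()

arrowBounded⇒arrow-2∷p : ∀ {G p} → 2 ≤ p → ArrowBounded G (p + 1) p → Arrow G (2 ∷ p ∷ [])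
arrowBounded⇒arrow-2∷p {p = p} 2≤p arr = arr (2 ∷ p ∷ [])
  ((s≤s z≤n , 2≤p) ∷ (ℕ.<⇒≤ 2≤p , ℕ.≤-refl) ∷ []) (wt 2≤p)
  where
  wt : ∀ {p} → 2 ≤ p → 1 + (pred p + 0) + 1 ≡ p + 1
  wt {suc p} _ = cong (λ n → suc n + 1) (ℕ.+-identityʳ p)

-- If `m ≤ p`, the single demand `m` forces an `m`-clique; if `m = p + 1`, the demands `(2, p)`
-- force a `p`-clique. Both contradict the absence of `(m-1)`-cliques.
hasMember⇒p+2≤m : ∀ {p m n} → 2 ≤ p → 1 ≤ m → HasMember p m n → p + 2 ≤ m
hasMember⇒p+2≤m {p} {suc m} 2≤p _ (G , hG , _) with H̃⁻ {G = G} hG | suc m ℕ.≤? p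
... | arr , ¬K | yes m≤p = contradiction (clique-≤ G (ℕ.n≤1+n m) Kₘ) ¬K
  where
  Kₘ : Clique G (suc m)
  Kₘ with arr (suc m ∷ []) ((s≤s z≤n , m≤p) ∷ []) (trans (cong (_+ 1) (ℕ.+-identityʳ m)) (ℕ.+-comm m 1)) (λ _ → zero)
  ... | zero , K , _ = K
... | arr , ¬K | no m≰p with m ℕ.≟ p
... | yes refl = contradiction
  (arrow-2∷a⇒clique {G} (arrowBounded⇒arrow-2∷p {G} 2≤p (subst (λ k → ArrowBounded G k p) (ℕ.+-comm 1 p) arr))) ¬K
... | no m≢p = subst (_≤ suc m) (ℕ.+-comm 2 p) (s≤s (ℕ.≤∧≢⇒< (s≤s⁻¹ (ℕ.≰⇒> m≰p)) (m≢p ∘ sym)))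

cone-hasMember : ∀ {p m n} → 1 ≤ m → HasMember p m n → HasMember p (suc m) (suc n)
cone-hasMember {m = suc m} _ (G , hG , refl) with H̃⁻ {G = G} hG
... | arr , ¬K = cone G , H̃⁺ {G = cone G} (cone-ArrowBounded {G} arr) (cone-¬clique {G} ¬K) , refl

cone^k-hasMember : ∀ {p m n} k → 1 ≤ m → HasMember p m n → HasMember p (k + m) (k + n)
cone^k-hasMember zero    1≤m h = h
cone^k-hasMember (suc k) 1≤m h = cone-hasMember (ℕ.≤-trans 1≤m (ℕ.m≤n+m _ k)) (cone^k-hasMember k 1≤m h)

-- Minimality of `m₀` and part (a).

module _ {p m₀ : ℕ} (isM₀ : IsM₀ p m₀) {f₀ : ℕ} (isF₀ : IsF̃ᵥ m₀ p (m₀ ∸ 1) f₀) where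

  -- Minimality of the excess `f₀ - m₀`, with the subtractions moved across so that it can be used
  -- in ℕ.
  excess-≤ : ∀ {m n} → p + 2 ≤ m → HasMember p m n → f₀ + m ≤ n + m₀
  excess-≤ {m} {n} p+2≤m h = decidable-stable (_ ℕ.≤? _) λ ¬le →
    minimum-¬¬ h λ (f , isF , f≤n) → ¬le (ℕ.≤-trans (bound isM₀ f isF) (ℕ.+-monoˡ-≤ m₀ f≤n))
    where
    bound : IsM₀ p m₀ → ∀ f → IsF̃ᵥ m p (m ∸ 1) f → f₀ + m ≤ f + m₀
    bound ((_ , d , (_ , least) , f₁ , isF₁ , refl) , _) f isF with minimum-unique isF₁ isF₀
    ... | refl = -‿≤⇒+-≤ f₀ m₀ f m (least _ (m , p+2≤m , f , isF , refl))

  -- Equality would make `m` an earlier index attaining the least excess.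
  excess-< : ∀ {m n} → p + 2 ≤ m → m < m₀ → HasMember p m n → f₀ + m < n + m₀
  excess-< {m} {n} p+2≤m m<m₀ h = decidable-stable (_ ℕ.<? _) λ ¬lt →
    minimum-¬¬ h λ (f , isF , f≤n) → ¬lt (ℕ.<-≤-trans
      (ℕ.≤∧≢⇒< (excess-≤ p+2≤m (proj₁ isF)) (λ eq → ℕ.<⇒≱ m<m₀ (least′ isM₀ f isF eq)))
      (ℕ.+-monoˡ-≤ m₀ f≤n))
    where
    least′ : IsM₀ p m₀ → ∀ f → IsF̃ᵥ m p (m ∸ 1) f → f₀ + m ≡ f + m₀ → m₀ ≤ m
    least′ ((_ , d , minEx , f₁ , isF₁ , refl) , least) f isF eq with minimum-unique isF₁ isF₀
    ... | refl = least m (ℕ.≤-trans (ℕ.m≤n+m 1 (p + 1)) (ℕ.≤-trans (ℕ.≤-reflexive (ℕ.+-assoc p 1 1)) p+2≤m)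
        , _ , minEx , f , isF , +-≡⇒-‿≡ f₀ m₀ f m eq)

  -- Taking `m - m₀` successive cones bounds the number from above, and minimality of the excess
  -- bounds it from below.
  partA : 1 ≤ m₀ → p + 2 ≤ m₀ → ∀ m → m₀ ≤ m → IsF̃ᵥ m p (m ∸ 1) (f₀ + m ∸ m₀)
  partA 1≤m₀ p+2≤m₀ m m₀≤m = subst₂ (HasMember p) (ℕ.m∸n+n≡m m₀≤m)
      (trans (ℕ.+-comm (m ∸ m₀) f₀) (sym (ℕ.+-∸-assoc f₀ m₀≤m)))
      (cone^k-hasMember (m ∸ m₀) 1≤m₀ (proj₁ isF₀))
    , λ n h → ℕ.m≤n+o⇒m∸n≤o (f₀ + m) m₀
        (ℕ.≤-trans (excess-≤ (ℕ.≤-trans p+2≤m₀ m₀≤m) h) (ℕ.≤-reflexive (ℕ.+-comm n m₀)))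

-- Cliques avoiding independent sets of an extremal graph: part (b).

∣∁p∣<n : ∀ {n} {p : Subset n} → Nonempty p → ∣ ∁ p ∣ < n
∣∁p∣<n {n} {p} (x , x∈p) = subst (∣ ∁ p ∣ <_) (∣⊤∣≡n n)
  (p⊂q⇒∣p∣<∣q∣ (⊆⊤ , x , ∈⊤ , x∈p⇒x∉∁p x∈p))

Avoidable : (G : Graph) → VertexSet G → ℕ → Set
Avoidable G A a = Σ[ K ∈ Clique G a ] (∀ j → proj₁ K j ∉ A)

-- If the first colour class contains no edge it is independent, and a clique avoiding it is
-- entirely of the second colour.
avoidable⇒arrow-2∷a : ∀ {G a} → (∀ A → Independent G (_∈ A) → Avoidable G A a) → Arrow G (2 ∷ a ∷ [])
avoidable⇒arrow-2∷a {G} {a} avoidable colour with Fin.any? (λ x → Fin.any? λ y →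
    (colour x Fin.≟ zero) ×-dec (colour y Fin.≟ zero) ×-dec (adj G x y Bool.≟ true))
... | yes (x , y , cx≡0 , cy≡0 , xy) = zero , (c , clq) , λ { zero → cx≡0 ; (suc zero) → cy≡0 }
  where
  c : Fin 2 → V G
  c zero    = x
  c (suc _) = y
  clq : IsCliqueMap G c
  clq {zero}     {zero}     i≢j = contradiction refl i≢j
  clq {zero}     {suc zero} _   = xy
  clq {suc zero} {zero}     _   = trans (adj-sym G y x) xy
  clq {suc zero} {suc zero} i≢j = contradiction refl i≢j
... | no ¬edge = suc zero , proj₁ avoiding , λ j → ≢zero⇒≡1 (proj₂ avoiding j ∘ ∈-comprehension⁺ zero?)
  where
  zero? : Decidable (λ x → colour x ≡ zero)
  zero? x = colour x Fin.≟ zero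
  avoiding : Avoidable G (comprehension zero?) a
  avoiding = avoidable (comprehension zero?) λ x∈ y∈ → Bool.¬-not λ xy →
    ¬edge (_ , _ , ∈-comprehension⁻ zero? x∈ , ∈-comprehension⁻ zero? y∈ , xy)
  ≢zero⇒≡1 : {i : Fin 2} → i ≢ zero → i ≡ suc zero
  ≢zero⇒≡1 {zero}     i≢0 = contradiction refl i≢0
  ≢zero⇒≡1 {suc zero} _   = refl

module _ {p a : ℕ} (2≤p : 2 ≤ p) (isM₀ : IsM₀ p (2 + a)) (p+2≤1+a : p + 2 ≤ suc a)
         {G : Graph} (hG : H̃ (2 + a) p (suc a) G) (isF : IsF̃ᵥ (2 + a) p (suc a) (order G)) where

  private
    arr : ArrowBounded G (2 + a) p
    arr = proj₁ (H̃⁻ {G = G} hG)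

  -- Otherwise removing A leaves a smaller graph with excess at m₀ - 1 no larger than at m₀.
  nonempty-avoidable : ∀ A → Nonempty A → Independent G (_∈ A) → Avoidable G A a
  nonempty-avoidable A ne indep with hasClique? (induced G (∁ A)) a
  ... | yes K = let c , clq = hasClique⇒clique (induced G (∁ A)) K in
    (enumerate (∁ A) ∘ c , clq) , λ j → x∈∁p⇒x∉p (enumerate-∈ (∁ A) (c j))
  -- At `m₀ - 1` strictness would give `order G + (1 + a) < ∣ ∁ A ∣ + (2 + a)`, which fails since
  -- `∣ ∁ A ∣ < order G`.
  ... | no ¬K = contradiction
    (ℕ.≤-trans (ℕ.≤-reflexive (ℕ.+-suc ∣ ∁ A ∣ (suc a))) (ℕ.+-monoˡ-≤ (suc a) (∣∁p∣<n ne)))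
    (ℕ.<⇒≱ (excess-< isM₀ isF p+2≤1+a ℕ.≤-refl
      (induced G (∁ A) , H̃⁺ {G = induced G (∁ A)} (remove-ArrowBounded {G} 2≤p indep arr)
        (¬K ∘ clique⇒hasClique (induced G (∁ A))) , refl)))

  someVertex : V G
  someVertex with arr (Vec.replicate (suc a) 2) (admissible-replicate-2 (suc a) 2≤p)
    (trans (cong (_+ 1) (weight-replicate-2 (suc a))) (ℕ.+-comm (suc a) 1)) (λ _ → zero)
  ... | zero , (c , _) , _ = c zero
  ... | suc i , (c , _) , _ = c (subst Fin (sym (Vec.lookup-replicate i 2)) zero)

  independent-avoidable : ∀ A → Independent G (_∈ A) → Avoidable G A a
  independent-avoidable A indep with nonempty? A
  ... | yes ne = nonempty-avoidable A ne indep
  -- The deletion argument needs the order to drop, so the empty set is replaced by a singleton.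
  ... | no ¬ne = proj₁ (nonempty-avoidable ⁅ z ⁆ (z , x∈⁅x⁆ z) singleton-indep) , λ _ x∈A → ¬ne (_ , x∈A)
    where
    z : V G
    z = someVertex
    singleton-indep : Independent G (_∈ ⁅ z ⁆)
    singleton-indep x∈ y∈ with x∈⁅y⁆⇒x≡y z x∈ | x∈⁅y⁆⇒x≡y z y∈
    ... | refl | refl = adj-irrefl G z

  arrow-2∷[m₀-2] : Arrow G (2 ∷ a ∷ [])
  arrow-2∷[m₀-2] = avoidable⇒arrow-2∷a {G} independent-avoidable

-- The order bound at `p + 2`, part (c) and the assembly.

-- Deleting two non-adjacent vertices and applying a+m≤order to what remains with a = p, m = p + 1.
2p+3≤order : ∀ {p G} → 2 ≤ p → ArrowBounded G (p + 2) p → ¬ Clique G (p + 1) → p + (p + 1) + 2 ≤ order G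
2p+3≤order {p} {G} 2≤p arr ¬K with Fin.any? (λ x → Fin.any? (nonAdj? G x))
-- Here `G` is complete. Colouring each vertex differently shows that its order is at least `p + 2`,
-- so it has a `(p+1)`-clique.
... | no ¬na = contradiction
  (clique-≤ G (ℕ.≤-trans (ℕ.+-monoʳ-≤ p (ℕ.n≤1+n 1))
      (colourable⇒m≤ {G = G} 2≤p arr (colourable-size G (order G) ⊤ (ℕ.≤-reflexive (∣⊤∣≡n (order G))))))
    (id , λ i≢j → ¬nonAdj⇒adj G i≢j λ na → ¬na (_ , _ , na))) ¬K
... | yes (x , y , x≢y , xy≡false) = begin
    p + (p + 1) + 2               ≤⟨ ℕ.+-monoˡ-≤ 2 (a+m≤order {G = G′} 2≤p arr′ ¬K′ (arrowBounded⇒arrow-2∷p {G′} 2≤p arr′)) ⟩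
    ∣ ∁ A ∣ + 2                   ≡⟨ cong (∣ ∁ A ∣ +_) ∣A∣≡2 ⟨
    ∣ ∁ A ∣ + ∣ A ∣               ≡⟨ cong (_+ ∣ A ∣) (∣∁p∣≡n∸∣p∣ A) ⟩
    order G ∸ ∣ A ∣ + ∣ A ∣       ≡⟨ ℕ.m∸n+n≡m (∣p∣≤n A) ⟩
    order G                       ∎
  where
  open ℕ.≤-Reasoning
  A : VertexSet G
  A = ⁅ x ⁆ ∪ ⁅ y ⁆
  G′ : Graph
  G′ = induced G (∁ A)
  ∣A∣≡2 : ∣ A ∣ ≡ 2
  ∣A∣≡2 = trans (x∉p⇒∣p∪⁅x⁆∣≡1+∣p∣ (x≢y⇒x∉⁅y⁆ (x≢y ∘ sym))) (cong suc (∣⁅x⁆∣≡1 x))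
  ∈A : ∀ {z} → z ∈ A → z ≡ x ⊎ z ≡ y
  ∈A z∈ = [ inj₁ ∘ x∈⁅y⁆⇒x≡y x , inj₂ ∘ x∈⁅y⁆⇒x≡y y ]′ (x∈p∪q⁻ ⁅ x ⁆ ⁅ y ⁆ z∈)
  indep : Independent G (_∈ A)
  indep u∈ v∈ = pair-independent G xy≡false (∈A u∈) (∈A v∈)
  arr′ : ArrowBounded G′ (p + 1) p
  arr′ = remove-ArrowBounded {G} 2≤p indep (subst (λ k → ArrowBounded G k p) (ℕ.+-suc p 1) arr)
  ¬K′ : ¬ Clique G′ (suc p)
  ¬K′ K = ¬K (subst (Clique G) (ℕ.+-comm 1 p) (induced-clique⁻ G (∁ A) K))

partB : ∀ {p m₀} → 2 ≤ p → IsM₀ p m₀ → p + 2 < m₀ → ∀ G → H̃ m₀ p (m₀ ∸ 1) G →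
  IsF̃ᵥ m₀ p (m₀ ∸ 1) (order G) → Arrow G (2 ∷ m₀ ∸ 2 ∷ [])
partB {p} {suc zero} _ _ (s≤s p+2≤0) _ _ _ = contradiction (ℕ.≤-trans (ℕ.m≤n+m 2 p) p+2≤0) λ ()
partB {p} {suc (suc a)} 2≤p isM₀ (s≤s p+2≤1+a) G hG isF = arrow-2∷[m₀-2] 2≤p isM₀ p+2≤1+a {G} hG isF

-- If `m₀ = p + 2`, the bound `f ≥ 2p + 3` suffices. Otherwise part (b) yields `f₀ ≥ 2m₀ - 2`, and
-- the strict inequality `f₀ + (p + 2) < f + m₀` gives `f > m₀ + p`.
partC : ∀ {p m₀ f₀ f} → 2 ≤ p → IsM₀ p m₀ → p + 2 ≤ m₀ → IsF̃ᵥ m₀ p (m₀ ∸ 1) f₀ →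
  IsF̃ᵥ (p + 2) p (p + 1) f → m₀ < f ∸ p
partC {p} {m₀} {f₀} {f} 2≤p isM₀ p+2≤m₀ isF₀ ((G , hG , refl) , _) with p + 2 ℕ.≟ m₀
... | yes refl = ℕ.m+n≤o⇒m≤o∸n (suc (p + 2)) (ℕ.≤-trans (ℕ.≤-reflexive (rearrange p))
    (2p+3≤order {p} {G} 2≤p (proj₁ (H̃⁻ {G = G} hG)) (proj₂ (H̃⁻ {G = G} hG))))
  where
  rearrange : ∀ p → suc (p + 2) + p ≡ p + (p + 1) + 2
  rearrange = solve-∀
... | no p+2≢m₀ = large m₀ isM₀ (ℕ.≤∧≢⇒< p+2≤m₀ p+2≢m₀) isF₀
  where
  large : ∀ m₀ → IsM₀ p m₀ → p + 2 < m₀ → IsF̃ᵥ m₀ p (m₀ ∸ 1) f₀ → m₀ < order G ∸ p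
  large (suc zero) _ (s≤s p+2≤0) _ = contradiction (ℕ.≤-trans (ℕ.m≤n+m 2 p) p+2≤0) λ ()
  large (suc (suc a)) isM₀ p+2<m₀ isF₀@((G₀ , hG₀ , refl) , _) =
    ℕ.m+n≤o⇒m≤o∸n (3 + a) (ℕ.+-cancelʳ-≤ (2 + a) _ _ (begin
      3 + a + p + (2 + a)               ≡⟨ rearrange a p ⟩
      suc (a + (2 + a) + (p + 2))       ≤⟨ s≤s (ℕ.+-monoˡ-≤ (p + 2)
                                             (a+m≤order {G = G₀} 2≤p (proj₁ h₀) (proj₂ h₀)
                                               (partB 2≤p isM₀ p+2<m₀ G₀ hG₀ isF₀))) ⟩
      suc (order G₀ + (p + 2))          ≤⟨ excess-< isM₀ isF₀ ℕ.≤-refl p+2<m₀ member ⟩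
      order G + (2 + a)                 ∎))
    where
    open ℕ.≤-Reasoning
    h₀ : ArrowBounded G₀ (2 + a) p × ¬ Clique G₀ (suc a)
    h₀ = H̃⁻ {G = G₀} hG₀
    member : HasMember p (p + 2) (order G)
    member = G , subst (λ q → H̃ (p + 2) p q G) (sym (ℕ.+-∸-assoc p (s≤s z≤n))) hG , refl
    rearrange : ∀ a p → 3 + a + p + (2 + a) ≡ suc (a + (2 + a) + (p + 2))
    rearrange = solve-∀

1≤p⇒p≡1⊎2≤p : ∀ {p} → 1 ≤ p → p ≡ 1 ⊎ 2 ≤ p
1≤p⇒p≡1⊎2≤p {suc zero}    _ = inj₁ refl
1≤p⇒p≡1⊎2≤p {suc (suc p)} _ = inj₂ (s≤s (s≤s z≤n))

theorem2p1 : (p m₀ : ℕ) → 1 ≤ p → IsM₀ p m₀ →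
    (∀ f₀ → IsF̃ᵥ m₀ p (m₀ ∸ 1) f₀ →
    ∀ m → m₀ ≤ m → IsF̃ᵥ m p (m ∸ 1) (f₀ + m ∸ m₀))
    × (p + 2 < m₀ →
    ∀ G → H̃ m₀ p (m₀ ∸ 1) G → IsF̃ᵥ m₀ p (m₀ ∸ 1) (order G) →
    G →ᵛ 2 ∷ m₀ ∸ 2 ∷ [])
    × (∀ f → IsF̃ᵥ (p + 2) p (p + 1) f → m₀ < f ∸ p)
theorem2p1 p m₀ 1≤p isM₀@((1≤m₀ , d , minEx , f₁ , isF₁ , _) , _) with 1≤p⇒p≡1⊎2≤p 1≤p
... | inj₁ refl = contradiction minEx ¬isMinExcess-1
... | inj₂ 2≤p =
    (λ f₀ isF₀ → partA isM₀ isF₀ 1≤m₀ p+2≤m₀)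
  , (λ p+2<m₀ G hG isF → Arrow⇒→ᵛ {G} (2 ∷ m₀ ∸ 2 ∷ []) (partB 2≤p isM₀ p+2<m₀ G hG isF))
  , λ f isF → partC 2≤p isM₀ p+2≤m₀ isF₁ isF
  where
  -- `m₀` is minimised over all positive integers, so this comes from the existence of a graph
  -- attaining `f₁`.
  p+2≤m₀ : p + 2 ≤ m₀
  p+2≤m₀ = hasMember⇒p+2≤m 2≤p 1≤m₀ (proj₁ isF₁)
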